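{- For any $n,k\in\mathbb{N}$, $\rho_k^n\ge 1+c_k$.
   Context: Let $\mathcal{C}$ be the unit circle in the Euclidean plane centered at the origin. For $n,k\in\mathbb{N}$, $k$ treasures are hidden at unknown points $\mathbf{T}=(T_1,\dots,T_k)\in\mathcal{C}^k$, and $n$ robots start at time $0$ at the origin. Each robot moves independently anywhere in the plane (not restricted to $\mathcal{C}$) with speed at most $1$. A treasure is discovered when the position of some robot coincides with it; upon discovery all robots instantly learn its location. A strategy specifies the motion of all $n$ robots, where at each time the motion may depend only on the information about treasures discovered so far; $\mathcal{S}_k^n$ is the set of all valid strategies for $n$ robots and $k$ treasures. For $S\in\mathcal{S}_k^n$ let $\rho_S(\mathbf{T})$ be the time required until every robot has individually visited (been at the location of) every treasure. Define $$\rho_k^n=\inf_{S\in\mathcal{S}_k^n}\ \sup_{\mathbf{T}\in\mathcal{C}^k}\rho_S(\mathbf{T}).$$ Separately, let $R=(1,0)$ and let $d(\cdot,\cdot)$ denote Euclidean distance. For $k\in\mathbb{N}$ define $$c_k=\sup_{(T_1,\dots,T_k)\in\mathcal{C}^k}\ \min_\sigma\Big(d(R,T_{\sigma(1)})+\sum_{i=2}^k d(T_{\sigma(i-1)},T_{\sigma(i)})\Big),$$ the minimum being over all permutations $\sigma$ of $\{1,\dots,k\}$. -}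

module Defs where

open import Level using (0ℓ)
open import Algebra.Bundles using (CommutativeRing)
open import Algebra.Structures using (IsCommutativeRing)
open import Axiom.ExcludedMiddle using (ExcludedMiddle)
open import Data.Fin.Base using (Fin; zero; suc)
open import Data.Fin.Permutation using (Permutation′; _⟨$⟩ʳ_)
open import Data.Nat.Base using (ℕ; zero; suc)
open import Data.Product.Base using (Σ; ∃; _×_; _,_; proj₁; proj₂)
open import Data.Sum.Base as Sum using (inj₁; inj₂; reduce)
open import Data.Vec.Functional using (Vector; tail)
open import Function.Bundles using (_⇔_)
open import Relation.Binary.Core using (Rel)
open import Relation.Binary.Structures using (IsTotalOrder)
open import Relation.Nullary using (¬_; yes; no; contradiction)
open import Relation.Nullary.Construct.Add.Extrema using (_±; ⊥±; ⊤±; [_])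

import Algebra.Properties.Ring
import Algebra.Solver.Ring.NaturalCoefficients.Default
import Relation.Binary.Construct.Add.Extrema.NonStrict
import Relation.Binary.Construct.Add.Supremum.NonStrict as AddSup

-- Any two Dedekind-complete ordered fields are isomorphic, so quantifying
-- over all of them is classically the same as speaking about the reals.
-- Equality is a setoid equality, so that reals may be represented by
-- Cauchy sequences or cuts without quotients.
record CompleteOrderedField : Set₁ where
  infix  8 -_
  infixl 7 _*_
  infixl 6 _+_
  infix  4 _≈_ _≤_
  field
    Carrier           : Set
    _≈_ _≤_           : Rel Carrier 0ℓ
    _+_ _*_           : Carrier → Carrier → Carrier
    -_                : Carrier → Carrier
    0# 1#             : Carrier
    isCommutativeRing : IsCommutativeRing _≈_ _+_ _*_ -_ 0# 1#
    isTotalOrder      : IsTotalOrder _≈_ _≤_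
    0≉1               : ¬ (0# ≈ 1#)
    inverse           : ∀ x → ¬ (x ≈ 0#) → ∃ λ y → x * y ≈ 1#
    +-monoˡ-≤         : ∀ z {x y} → x ≤ y → x + z ≤ y + z
    *-nonneg          : ∀ {x y} → 0# ≤ x → 0# ≤ y → 0# ≤ x * y
    complete          : (P : Carrier → Set) → ∃ P →
                        (∃ λ u → ∀ x → P x → x ≤ u) →
                        ∃ λ s → (∀ x → P x → x ≤ s) ×
                                (∀ u → (∀ x → P x → x ≤ u) → s ≤ u)

  commutativeRing : CommutativeRing 0ℓ 0ℓ
  commutativeRing = record { isCommutativeRing = isCommutativeRing }

  open CommutativeRing commutativeRing public
    using (_-_; refl; sym; trans; reflexive; setoid; ring; commutativeSemiring;
           +-cong; +-congˡ; +-congʳ; +-comm; +-assoc; +-identityˡ; +-identityʳ;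
           -‿cong; -‿inverseˡ; -‿inverseʳ;
           *-cong; *-congˡ; *-congʳ; *-comm; *-assoc; *-identityˡ; *-identityʳ;
           distribˡ; distribʳ; zeroˡ; zeroʳ)

  open IsTotalOrder isTotalOrder public
    using (total; antisym; ≤-respˡ-≈; ≤-respʳ-≈)
    renaming (refl to ≤-refl; reflexive to ≤-reflexive; trans to ≤-trans)

module Reals (em : ExcludedMiddle 0ℓ) (F : CompleteOrderedField) where

  open CompleteOrderedField F public renaming (Carrier to ℝ)
  open Relation.Binary.Construct.Add.Extrema.NonStrict _≤_ public

  private
    module Solver =
      Algebra.Solver.Ring.NaturalCoefficients.Default commutativeSemiring
    open Solver using (solve; _:+_; _:*_; _:=_; con)
    open Algebra.Properties.Ring ring using (-‿distribˡ-*; -‿distribʳ-*; -‿involutive)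

  infixr 4 _⟨≤⟩_
  _⟨≤⟩_ : ∀ {x y z} → x ≤ y → y ≤ z → x ≤ z
  _⟨≤⟩_ = ≤-trans

  ≈⇒≤ : ∀ {x y} → x ≈ y → x ≤ y
  ≈⇒≤ = ≤-reflexive

  +-monoʳ : ∀ z {x y} → x ≤ y → z + x ≤ z + y
  +-monoʳ z p = ≈⇒≤ (+-comm _ _) ⟨≤⟩ +-monoˡ-≤ z p ⟨≤⟩ ≈⇒≤ (+-comm _ _)

  +-nonneg : ∀ {x y} → 0# ≤ x → 0# ≤ y → 0# ≤ x + y
  +-nonneg {x} {y} p q =
    p ⟨≤⟩ ≈⇒≤ (sym (+-identityʳ x)) ⟨≤⟩ +-monoʳ x q

  x≤x+p : ∀ x {p} → 0# ≤ p → x ≤ x + p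
  x≤x+p x q = ≈⇒≤ (sym (+-identityʳ x)) ⟨≤⟩ +-monoʳ x q

  gap : ∀ {x y} → x ≤ y → ∃ λ p → 0# ≤ p × y ≈ x + p
  gap {x} {y} x≤y = y - x , nonneg , y≈
    where
    nonneg : 0# ≤ y - x
    nonneg = ≈⇒≤ (sym (-‿inverseʳ x)) ⟨≤⟩ +-monoˡ-≤ (- x) x≤y
    y≈ : y ≈ x + (y - x)
    y≈ = sym (trans (+-comm _ _) (trans (+-assoc _ _ _)
           (trans (+-congˡ (-‿inverseˡ x)) (+-identityʳ y))))

  +-cancelʳ-≤ : ∀ z {x y} → x + z ≤ y + z → x ≤ y
  +-cancelʳ-≤ z {x} {y} p =
    ≈⇒≤ (sym (undo x)) ⟨≤⟩ +-monoˡ-≤ (- z) p ⟨≤⟩ ≈⇒≤ (undo y)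
    where
    undo : ∀ v → (v + z) - z ≈ v
    undo v = trans (+-assoc _ _ _) (trans (+-congˡ (-‿inverseʳ z)) (+-identityʳ v))

  *-monoˡ : ∀ {z x y} → 0# ≤ z → x ≤ y → z * x ≤ z * y
  *-monoˡ {z} {x} 0≤z x≤y with p , 0≤p , y≈ ← gap x≤y =
    x≤x+p (z * x) (*-nonneg 0≤z 0≤p) ⟨≤⟩
    ≈⇒≤ (trans (sym (distribˡ z x p)) (*-congˡ (sym y≈)))

  rearrangement : ∀ {a b c d} → a ≤ c → b ≤ d →
                  a * d + c * b ≤ a * b + c * d
  rearrangement {a} {b} {c} {d} a≤c b≤d
    with p , 0≤p , c≈ ← gap a≤c | q , 0≤q , d≈ ← gap b≤d =
    ≈⇒≤ (+-cong (*-congˡ d≈) (*-congʳ c≈)) ⟨≤⟩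
    x≤x+p _ (*-nonneg 0≤p 0≤q) ⟨≤⟩
    ≈⇒≤ (solve 4 (λ a b p q →
           (a :* (b :+ q) :+ (a :+ p) :* b) :+ p :* q :=
           a :* b :+ (a :+ p) :* (b :+ q)) refl a b p q) ⟨≤⟩
    ≈⇒≤ (+-congˡ (*-cong (sym c≈) (sym d≈)))

  rearrangement′ : ∀ {a b c d} → a ≤ c → b ≤ d →
                   c * b + a * d ≤ c * d + a * b
  rearrangement′ a≤c b≤d =
    ≈⇒≤ (+-comm _ _) ⟨≤⟩ rearrangement a≤c b≤d ⟨≤⟩ ≈⇒≤ (+-comm _ _)

  square-nonneg : ∀ x → 0# ≤ x * x
  square-nonneg x with total 0# x
  ... | inj₁ 0≤x = *-nonneg 0≤x 0≤x
  ... | inj₂ x≤0 = *-nonneg 0≤-x 0≤-x ⟨≤⟩ ≈⇒≤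
      (trans (sym (-‿distribˡ-* x (- x)))
      (trans (-‿cong (sym (-‿distribʳ-* x x))) (-‿involutive (x * x))))
    where
    0≤-x : 0# ≤ - x
    0≤-x = ≈⇒≤ (sym (-‿inverseʳ x)) ⟨≤⟩ +-monoˡ-≤ (- x) x≤0 ⟨≤⟩ ≈⇒≤ (+-identityˡ _)

  0≤1 : 0# ≤ 1#
  0≤1 = square-nonneg 1# ⟨≤⟩ ≈⇒≤ (*-identityˡ 1#)

  square≤0 : ∀ x → x * x ≤ 0# → x ≈ 0#
  square≤0 x x²≤0 with em {x ≈ 0#}
  ... | yes x≈0 = x≈0
  ... | no  x≉0 with w , xw≈1 ← inverse x x≉0 =
    contradiction (antisym 0≤1 1≤0) 0≉1
    where
    1≤0 : 1# ≤ 0#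
    1≤0 = ≈⇒≤ (sym (trans (*-cong xw≈1 xw≈1) (*-identityˡ 1#))) ⟨≤⟩
          ≈⇒≤ (solve 2 (λ x w → (x :* w) :* (x :* w) := (w :* w) :* (x :* x)) refl x w) ⟨≤⟩
          *-monoˡ (square-nonneg w) x²≤0 ⟨≤⟩
          ≈⇒≤ (zeroʳ (w * w))

  square-cancel-≤ : ∀ {z y} → 0# ≤ y → z * z ≤ y * y → z ≤ y
  square-cancel-≤ {z} {y} 0≤y z²≤y² with total z y
  ... | inj₁ z≤y = z≤y
  ... | inj₂ y≤z with p , 0≤p , z≈ ← gap y≤z =
    ≈⇒≤ (trans z≈ (trans (+-congˡ (square≤0 p p²≤0)) (+-identityʳ y)))
    where
    0≤yp : 0# ≤ y * p
    0≤yp = *-nonneg 0≤y 0≤p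
    p²≤0 : p * p ≤ 0#
    p²≤0 = +-cancelʳ-≤ (y * y)
      (x≤x+p _ (+-nonneg 0≤yp 0≤yp) ⟨≤⟩
       ≈⇒≤ (solve 2 (λ y p → (p :* p :+ y :* y) :+ (y :* p :+ y :* p) :=
                             (y :+ p) :* (y :+ p)) refl y p) ⟨≤⟩
       ≈⇒≤ (*-cong (sym z≈) (sym z≈)) ⟨≤⟩
       z²≤y² ⟨≤⟩ ≈⇒≤ (sym (+-identityˡ _)))

  -- s is the supremum of the y with y² ≤ x.  With b = 1 + x, the mean
  -- (x + s b) / (s + b) lies between s and x / s, and its square lies on the
  -- same side of x as s².
  sqrt-exists : ∀ x → 0# ≤ x → ∃ λ s → 0# ≤ s × s * s ≈ x
  sqrt-exists x 0≤x = s , 0≤s , antisym s²≤x x≤s²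
    where
    P : ℝ → Set
    P y = y * y ≤ x

    b : ℝ
    b = 1# + x

    0≤b : 0# ≤ b
    0≤b = +-nonneg 0≤1 0≤x

    x≤b² : x ≤ b * b
    x≤b² = x≤x+p x (+-nonneg 0≤b (square-nonneg x)) ⟨≤⟩
      ≈⇒≤ (solve 1 (λ x → x :+ ((con 1 :+ x) :+ x :* x) :=
                          (con 1 :+ x) :* (con 1 :+ x)) refl x)

    lub : ∃ λ s → (∀ y → P y → y ≤ s) × (∀ u → (∀ y → P y → y ≤ u) → s ≤ u)
    lub = complete P (0# , (≈⇒≤ (zeroˡ 0#) ⟨≤⟩ 0≤x))
                     (b , λ y y²≤x → square-cancel-≤ 0≤b (y²≤x ⟨≤⟩ x≤b²))

    s : ℝ
    s = proj₁ lub

    0≤s : 0# ≤ s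
    0≤s = proj₁ (proj₂ lub) 0# (≈⇒≤ (zeroˡ 0#) ⟨≤⟩ 0≤x)

    D N : ℝ
    D = s + b
    N = x + s * b

    0≤D : 0# ≤ D
    0≤D = +-nonneg 0≤s 0≤b

    1≤D : 1# ≤ D
    1≤D = x≤x+p 1# (+-nonneg 0≤s 0≤x) ⟨≤⟩
      ≈⇒≤ (solve 2 (λ s x → con 1 :+ (s :+ x) := s :+ (con 1 :+ x)) refl s x)

    D≉0 : ¬ (D ≈ 0#)
    D≉0 D≈0 = 0≉1 (antisym 0≤1 (1≤D ⟨≤⟩ ≈⇒≤ D≈0))

    w : ℝ
    w = proj₁ (inverse D D≉0)

    Dw≈1 : D * w ≈ 1#
    Dw≈1 = proj₂ (inverse D D≉0)

    0≤w : 0# ≤ w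
    0≤w = *-nonneg (square-nonneg w) 0≤D ⟨≤⟩
      ≈⇒≤ (trans (solve 2 (λ D w → (w :* w) :* D := (D :* w) :* w) refl D w)
          (trans (*-congʳ Dw≈1) (*-identityˡ w)))

    y : ℝ
    y = N * w

    0≤y : 0# ≤ y
    0≤y = *-nonneg (+-nonneg 0≤x (*-nonneg 0≤s 0≤b)) 0≤w

    Dy≈N : D * y ≈ N
    Dy≈N = trans (solve 3 (λ D N w → D :* (N :* w) := (D :* w) :* N) refl D N w)
                 (trans (*-congʳ Dw≈1) (*-identityˡ N))

    Ds≈ : D * s ≈ s * s + s * b
    Ds≈ = solve 2 (λ s b → (s :+ b) :* s := s :* s :+ s :* b) refl s b

    N²≈ : N * N ≈ ((s * s) * (b * b) + x * x) + (s * (b * x) + s * (b * x))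
    N²≈ = solve 3 (λ s b x → (x :+ s :* b) :* (x :+ s :* b) :=
            ((s :* s) :* (b :* b) :+ x :* x) :+ (s :* (b :* x) :+ s :* (b :* x)))
            refl s b x

    xD²≈ : x * (D * D) ≈ ((s * s) * x + x * (b * b)) + (s * (b * x) + s * (b * x))
    xD²≈ = solve 3 (λ s b x → x :* ((s :+ b) :* (s :+ b)) :=
            ((s :* s) :* x :+ x :* (b :* b)) :+ (s :* (b :* x) :+ s :* (b :* x)))
            refl s b x

    w²N²≈ : (w * w) * (N * N) ≈ y * y
    w²N²≈ = solve 2 (λ w N → (w :* w) :* (N :* N) := (N :* w) :* (N :* w)) refl w N

    w²xD²≈ : (w * w) * (x * (D * D)) ≈ x
    w²xD²≈ =
      trans (solve 3 (λ w x D → (w :* w) :* (x :* (D :* D)) :=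
                                x :* ((D :* w) :* (D :* w))) refl w x D)
      (trans (*-congˡ (trans (*-cong Dw≈1 Dw≈1) (*-identityˡ 1#))) (*-identityʳ x))

    s²≤x-from : x ≤ s * s → s * s ≤ x
    s²≤x-from x≤s² = +-cancelʳ-≤ (s * b)
        (≈⇒≤ (sym Ds≈) ⟨≤⟩ *-monoˡ 0≤D s≤y ⟨≤⟩ ≈⇒≤ Dy≈N)
      where
      xD²≤N² : x * (D * D) ≤ N * N
      xD²≤N² = ≈⇒≤ xD²≈ ⟨≤⟩ +-monoˡ-≤ _ (rearrangement′ x≤s² x≤b²) ⟨≤⟩ ≈⇒≤ (sym N²≈)
      x≤y² : x ≤ y * y
      x≤y² = ≈⇒≤ (sym w²xD²≈) ⟨≤⟩ *-monoˡ (square-nonneg w) xD²≤N² ⟨≤⟩ ≈⇒≤ w²N²≈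
      s≤y : s ≤ y
      s≤y = proj₂ (proj₂ lub) y λ z z²≤x → square-cancel-≤ 0≤y (z²≤x ⟨≤⟩ x≤y²)

    s²≤x : s * s ≤ x
    s²≤x = reduce (Sum.map₂ s²≤x-from (total (s * s) x))

    x≤s² : x ≤ s * s
    x≤s² = +-cancelʳ-≤ (s * b)
        (≈⇒≤ (sym Dy≈N) ⟨≤⟩ *-monoˡ 0≤D y≤s ⟨≤⟩ ≈⇒≤ Ds≈)
      where
      N²≤xD² : N * N ≤ x * (D * D)
      N²≤xD² = ≈⇒≤ N²≈ ⟨≤⟩ +-monoˡ-≤ _ (rearrangement s²≤x x≤b²) ⟨≤⟩ ≈⇒≤ (sym xD²≈)
      y≤s : y ≤ s
      y≤s = proj₁ (proj₂ lub) y
        (≈⇒≤ (sym w²N²≈) ⟨≤⟩ *-monoˡ (square-nonneg w) N²≤xD² ⟨≤⟩ ≈⇒≤ w²xD²≈)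

  ℝ± : Set
  ℝ± = ℝ ±

  infixr 6 _+±_
  _+±_ : ℝ → ℝ± → ℝ±
  r +± ⊥±    = ⊥±
  r +± [ x ] = [ r + x ]
  r +± ⊤±    = ⊤±

  IsSupremum IsInfimum : {I : Set} → (I → ℝ±) → ℝ± → Set
  IsSupremum f s = (∀ i → f i ≤± s) × (∀ u → (∀ i → f i ≤± u) → s ≤± u)
  IsInfimum  f s = (∀ i → s ≤± f i) × (∀ u → (∀ i → u ≤± f i) → u ≤± s)

  supremum : {I : Set} (f : I → ℝ±) → ∃ (IsSupremum f)
  supremum f with em {∃ λ u → ∀ i → f i ≤± [ u ]}
  ... | no unbounded = ⊤± , (λ i → f i ≤⊤±) , least
    where
    least : ∀ u → (∀ i → f i ≤± u) → ⊤± ≤± u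
    least ⊥±    ub = contradiction (0# , λ i → ≤±-trans ≤-trans (ub i) (⊥±≤ _)) unbounded
    least [ u ] ub = contradiction (u , ub) unbounded
    least ⊤±    ub = ⊤±≤⊤±
  ... | yes (u , f≤u) with em {∃ λ r → ∃ λ i → [ r ] ≤± f i}
  ...   | no empty = ⊥± , (λ i → below (f i) λ r r≤ → empty (r , i , r≤)) , λ v _ → ⊥±≤ v
    where
    below : ∀ a → (∀ r → ¬ ([ r ] ≤± a)) → a ≤± ⊥±
    below ⊥±    _ = ⊥±≤⊥±
    below [ x ] h = contradiction [ ≤-refl ] (h x)
    below ⊤±    h = contradiction [ 0# ]≤⊤± (h 0#)
  ...   | yes nonempty with s , upper , least ← complete (λ r → ∃ λ i → [ r ] ≤± f i) nonempty
                              (u , λ { r (i , r≤) → [≤]-injective (≤±-trans ≤-trans r≤ (f≤u i)) }) =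
    [ s ] , (λ i → below (f i) (f≤u i) λ r r≤ → upper r (i , r≤)) , above
    where
    below : ∀ a → a ≤± [ u ] → (∀ r → [ r ] ≤± a → r ≤ s) → a ≤± [ s ]
    below ⊥±    _  _ = ⊥±≤ [ s ]
    below [ x ] _  h = [ h x [ ≤-refl ] ]
    below ⊤±    () _
    above : ∀ v → (∀ i → f i ≤± v) → [ s ] ≤± v
    above ⊥±    ub = contradiction (≤±-trans ≤-trans (proj₂ (proj₂ nonempty)) (ub _)) λ { (AddSup.[ () ]) }
    above [ v ] ub = [ least v (λ { r (i , r≤) → [≤]-injective (≤±-trans ≤-trans r≤ (ub i)) }) ]
    above ⊤±    ub = [ s ]≤⊤±

  infimum : {I : Set} (f : I → ℝ±) → ∃ (IsInfimum f)
  infimum f with s , upper , least ← supremum {∃ λ u → ∀ i → u ≤± f i} proj₁ =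
    s , (λ i → least (f i) λ { (_ , lb) → lb i }) , λ u lb → upper (u , lb)

  sup inf : {I : Set} → (I → ℝ±) → ℝ±
  sup f = proj₁ (supremum f)
  inf f = proj₁ (infimum f)

  Point : Set
  Point = ℝ × ℝ

  infix 4 _≈ₚ_
  _≈ₚ_ : Rel Point 0ℓ
  (x , y) ≈ₚ (x′ , y′) = x ≈ x′ × y ≈ y′

  private
    distance-exists : (p q : Point) →
      let (x , y) = p ; (x′ , y′) = q in
      ∃ λ r → 0# ≤ r × r * r ≈ (x - x′) * (x - x′) + (y - y′) * (y - y′)
    distance-exists _ _ =
      sqrt-exists _ (+-nonneg (square-nonneg _) (square-nonneg _))

  d : Point → Point → ℝ
  d p q = proj₁ (distance-exists p q)

  d-nonneg : ∀ p q → 0# ≤ d p q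
  d-nonneg p q = proj₁ (proj₂ (distance-exists p q))

  d-square : ∀ p q → let (x , y) = p ; (x′ , y′) = q in
    d p q * d p q ≈ (x - x′) * (x - x′) + (y - y′) * (y - y′)
  d-square p q = proj₂ (proj₂ (distance-exists p q))

  origin R : Point
  origin = 0# , 0#
  R      = 1# , 0#

  𝒞 : Set
  𝒞 = Σ Point λ p → d origin p ≈ 1#

module TreasureHunt (em : ExcludedMiddle 0ℓ) (F : CompleteOrderedField) where

  open Reals em F public

  Treasures : ℕ → Set
  Treasures k = Fin k → 𝒞

  location : ∀ {k} → Treasures k → Fin k → Point
  location T j = proj₁ (T j)

  -- The trajectories of the n robots for every placement of the treasures;
  -- only the values at times t with 0 ≤ t are meaningful.
  Motion : ℕ → ℕ → Set
  Motion n k = Treasures k → Fin n → ℝ → Point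

  module _ {n k : ℕ} (X : Motion n k) where

    VisitedBy : Treasures k → ℝ → Fin n → Fin k → Set
    VisitedBy T t i j = ∃ λ u → 0# ≤ u × u ≤ t × X T i u ≈ₚ location T j

    DiscoveredBy : Treasures k → ℝ → Fin k → Set
    DiscoveredBy T t j = ∃ λ i → VisitedBy T t i j

    -- The robots cannot tell T from T′ by time t: the same treasures have been
    -- discovered, at the same times and at the same locations.
    SameInformation : Treasures k → Treasures k → ℝ → Set
    SameInformation T T′ t = ∀ s → 0# ≤ s → s ≤ t → ∀ j →
      (DiscoveredBy T s j ⇔ DiscoveredBy T′ s j) ×
      (DiscoveredBy T s j → location T j ≈ₚ location T′ j)

  record Strategy (n k : ℕ) : Set where
    field
      position : Motion n k
      start    : ∀ T i → position T i 0# ≈ₚ origin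
      speed    : ∀ T i {s t} → 0# ≤ s → s ≤ t →
                 d (position T i s) (position T i t) ≤ t - s
      causal   : ∀ T T′ t → 0# ≤ t → SameInformation position T T′ t →
                 ∀ i → position T i t ≈ₚ position T′ i t

  AllVisited : ∀ {n k} → Strategy n k → Treasures k → ℝ → Set
  AllVisited S T t = ∀ i j → VisitedBy (Strategy.position S) T t i j

  -- ⊤± if some robot never visits some treasure.
  completionTime : ∀ {n k} → Strategy n k → Treasures k → ℝ±
  completionTime S T =
    inf {I = ∃ λ t → 0# ≤ t × AllVisited S T t} λ (t , _) → [ t ]

  ρ : ℕ → ℕ → ℝ±
  ρ n k = inf λ (S : Strategy n k) → sup λ (T : Treasures k) → completionTime S T

  pathLength : ∀ {k} → Point → Vector Point k → ℝ
  pathLength {zero}  p q = 0#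
  pathLength {suc k} p q = d p (q zero) + pathLength (q zero) (tail q)

  c : ℕ → ℝ±
  c k = sup λ (T : Treasures k) → inf λ (σ : Permutation′ k) →
    [ pathLength R (λ i → location T (σ ⟨$⟩ʳ i)) ]

{-# OPTIONS --safe #-}

-- Until some robot first reaches the circle, no treasure can have been
-- discovered, so the robots move in the same way for all placements.  Let this
-- happen at time t₀, at the point P; then t₀ ≥ 1.  Rotate a given placement so
-- that R goes to P: the robot that is at P at time t₀ has yet to travel a path
-- through all the treasures, whose length is invariant under the rotation.

module Submission where

open import Defs
open import Level using (0ℓ)
open import Axiom.ExcludedMiddle using (ExcludedMiddle)
open import Data.Empty using (⊥-elim)
open import Data.Fin.Base using (Fin; zero; suc; punchIn)
open import Data.Fin.Permutation as Perm using (Permutation′; _⟨$⟩ʳ_)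
open import Data.Nat.Base using (ℕ; zero; suc; NonZero)
open import Data.Product.Base using (∃; _×_; _,_; proj₁; proj₂)
open import Data.Sum.Base using (_⊎_; inj₁; inj₂; [_,_]′)
open import Data.Vec.Functional using (Vector)
open import Function.Base using (_∘_)
open import Function.Bundles using (mk⇔)
open import Relation.Binary.PropositionalEquality.Core as ≡ using (_≡_)
open import Relation.Nullary using (¬_; Dec; yes; no; contradiction)
open import Relation.Nullary.Decidable using (decidable-stable)
open import Relation.Nullary.Construct.Add.Extrema using (⊥±; ⊤±; [_])

import Algebra.Properties.Ring
import Algebra.Solver.Ring.NaturalCoefficients.Default

-- Unlike origin, this does not depend on the excluded middle, so that distances
-- to it are compared without unfolding the construction of square roots.
centre : (F : CompleteOrderedField) → let open CompleteOrderedField F in Carrier × Carrier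
centre F = 0# , 0#
  where open CompleteOrderedField F

module _ (em : ExcludedMiddle 0ℓ) (F : CompleteOrderedField) where

  open TreasureHunt em F
  open Algebra.Properties.Ring ring using (-‿distribʳ-*; -‿+-comm)
  private
    module Solver =
      Algebra.Solver.Ring.NaturalCoefficients.Default commutativeSemiring
  open Solver using (solve; _:+_; _:*_; _:=_; con)

  -- Ordered field arithmetic

  +-mono : ∀ {a b x y} → a ≤ b → x ≤ y → a + x ≤ b + y
  +-mono p q = +-monoˡ-≤ _ p ⟨≤⟩ +-monoʳ _ q

  +-cancelˡ-≤ : ∀ z {x y} → z + x ≤ z + y → x ≤ y
  +-cancelˡ-≤ z p = +-cancelʳ-≤ z (≈⇒≤ (+-comm _ _) ⟨≤⟩ p ⟨≤⟩ ≈⇒≤ (+-comm _ _))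

  x-y+y≈x : ∀ x y → (x - y) + y ≈ x
  x-y+y≈x x y = trans (+-assoc _ _ _) (trans (+-congˡ (-‿inverseˡ y)) (+-identityʳ x))

  x≤y-z⇒x+z≤y : ∀ {x y z} → x ≤ y - z → x + z ≤ y
  x≤y-z⇒x+z≤y {z = z} p = +-monoˡ-≤ z p ⟨≤⟩ ≈⇒≤ (x-y+y≈x _ z)

  x+z≤y⇒x≤y-z : ∀ {x y z} → x + z ≤ y → x ≤ y - z
  x+z≤y⇒x≤y-z {z = z} p = +-cancelʳ-≤ z (p ⟨≤⟩ ≈⇒≤ (sym (x-y+y≈x _ z)))

  x+z≤y⇒x≤y : ∀ {x y z} → 0# ≤ z → x + z ≤ y → x ≤ y
  x+z≤y⇒x≤y 0≤z p = x≤x+p _ 0≤z ⟨≤⟩ p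

  ≰⇒≥ : ∀ {x y} → ¬ (x ≤ y) → y ≤ x
  ≰⇒≥ {x} {y} x≰y = [ (λ x≤y → contradiction x≤y x≰y) , (λ y≤x → y≤x) ]′ (total x y)

  1≰0 : ¬ (1# ≤ 0#)
  1≰0 1≤0 = 0≉1 (antisym 0≤1 1≤0)

  3≉0 : ¬ (1# + (1# + 1#) ≈ 0#)
  3≉0 3≈0 = 1≰0 (x≤x+p 1# (+-nonneg 0≤1 0≤1) ⟨≤⟩ ≈⇒≤ 3≈0)

  third : ∀ x → ∃ λ g → g + (g + g) ≈ x
  third x with w , 3w≈1 ← inverse (1# + (1# + 1#)) 3≉0 =
    x * w ,
    trans (solve 2 (λ x w → x :* w :+ (x :* w :+ x :* w) :=
                            x :* ((con 1 :+ (con 1 :+ con 1)) :* w)) refl x w)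
          (trans (*-congˡ 3w≈1) (*-identityʳ x))

  lower-bound-positive : ∀ {x y} → ¬ (x ≤ 0#) → ¬ (y ≤ 0#) →
                         ∃ λ m → ¬ (m ≤ 0#) × m ≤ x × m ≤ y
  lower-bound-positive {x} {y} x≰0 y≰0 with total x y
  ... | inj₁ x≤y = x , x≰0 , ≤-refl , x≤y
  ... | inj₂ y≤x = y , y≰0 , y≤x , ≤-refl

  -- If D were positive, s = t - g with 3 g ≤ min D t would violate the bound.
  ≤0-from-left : ∀ {D t} → ¬ (t ≤ 0#) →
                 (∀ s → 0# ≤ s → ¬ (t ≤ s) → D + (s + s) ≤ t + t) → D ≤ 0#
  ≤0-from-left {D} {t} t≰0 h = decidable-stable em λ D≰0 →
    let m , m≰0 , m≤D , m≤t = lower-bound-positive D≰0 t≰0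
        g , 3g≈m            = third m
    in m≰0 (3g≤0 m g 3g≈m (g≤0 m g 3g≈m m≤D m≤t))
    where
    3g≤0 : ∀ m g → g + (g + g) ≈ m → g ≤ 0# → m ≤ 0#
    3g≤0 m g 3g≈m g≤0 =
      ≈⇒≤ (sym 3g≈m) ⟨≤⟩ +-mono g≤0 (+-mono g≤0 g≤0) ⟨≤⟩
      ≈⇒≤ (trans (+-identityˡ _) (+-identityˡ _))
    g≤0 : ∀ m g → g + (g + g) ≈ m → m ≤ D → m ≤ t → g ≤ 0#
    g≤0 m g 3g≈m m≤D m≤t = decidable-stable em λ g≰0 →
      let 0≤g : 0# ≤ g
          0≤g = ≰⇒≥ g≰0
          0≤s : 0# ≤ t - g
          0≤s = x+z≤y⇒x≤y-z (≈⇒≤ (+-identityˡ g) ⟨≤⟩ x≤x+p g (+-nonneg 0≤g 0≤g) ⟨≤⟩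
                             ≈⇒≤ 3g≈m ⟨≤⟩ m≤t)
          t≰s : ¬ (t ≤ t - g)
          t≰s t≤s = g≰0 (+-cancelˡ-≤ t (x≤y-z⇒x+z≤y t≤s ⟨≤⟩ ≈⇒≤ (sym (+-identityʳ t))))
      in g≰0 (cancel (t - g) g (+-monoˡ-≤ _ (≈⇒≤ 3g≈m ⟨≤⟩ m≤D) ⟨≤⟩ h (t - g) 0≤s t≰s ⟨≤⟩
                                ≈⇒≤ (sym (+-cong (x-y+y≈x t g) (x-y+y≈x t g)))))
      where
      cancel : ∀ s g → (g + (g + g)) + (s + s) ≤ (s + g) + (s + g) → g ≤ 0#
      cancel s g le = +-cancelʳ-≤ ((g + g) + (s + s))
        (≈⇒≤ (solve 2 (λ g s → g :+ ((g :+ g) :+ (s :+ s)) :=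
                               (g :+ (g :+ g)) :+ (s :+ s)) refl g s) ⟨≤⟩
         le ⟨≤⟩
         ≈⇒≤ (solve 2 (λ g s → (s :+ g) :+ (s :+ g) :=
                               con 0 :+ ((g :+ g) :+ (s :+ s))) refl g s))

  -- Both sides become equal once the vanishing terms `y * (x + y)` and `x * (x + y)` are added to
  -- them. Taking opposites as a vanishing sum leaves `solve` an identity with natural coefficients.
  x+y≈0⇒x²≈y² : ∀ x y → x + y ≈ 0# → x * x ≈ y * y
  x+y≈0⇒x²≈y² x y x+y≈0 =
    trans (sym (+-identityʳ _))
    (trans (+-congˡ (sym (trans (*-congˡ x+y≈0) (zeroʳ y))))
    (trans (solve 2 (λ x y → x :* x :+ y :* (x :+ y) :=
                             x :* (x :+ y) :+ y :* y) refl x y)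
    (trans (+-congʳ (trans (*-congˡ x+y≈0) (zeroʳ x))) (+-identityˡ _))))

  -x²≈x² : ∀ x → (- x) * (- x) ≈ x * x
  -x²≈x² x = x+y≈0⇒x²≈y² (- x) x (-‿inverseˡ x)

  -- The Brahmagupta identity, with n in place of - b.
  norm-product : ∀ a b n x y → n + b ≈ 0# →
    (a * x + n * y) * (a * x + n * y) + (b * x + a * y) * (b * x + a * y) ≈
    (a * a + b * b) * (x * x + y * y)
  norm-product a b n x y n+b≈0 =
    trans (solve 5 (λ a b n x y →
             (a :* x :+ n :* y) :* (a :* x :+ n :* y) :+
             (b :* x :+ a :* y) :* (b :* x :+ a :* y) :=
             ((a :* a :+ b :* b) :* (x :* x) :+ (a :* a :+ n :* n) :* (y :* y)) :+
             (n :+ b) :* (a :* (x :* y) :+ a :* (x :* y))) refl a b n x y)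
    (trans (+-cong (+-congˡ (*-congʳ (+-congˡ (x+y≈0⇒x²≈y² n b n+b≈0))))
                   (trans (*-congʳ n+b≈0) (zeroˡ _)))
    (trans (+-identityʳ _) (sym (distribˡ _ _ _))))

  -- Cauchy-Schwarz. By `norm-product` with `- b` for its `b`, the square of `α * β` is the square
  -- of the left side plus a second square, which is dropped.
  dot≤ : ∀ {a b x y α β} → 0# ≤ α → 0# ≤ β →
         α * α ≈ a * a + b * b → β * β ≈ x * x + y * y →
         a * x + b * y ≤ α * β
  dot≤ {a} {b} {x} {y} {α} {β} 0≤α 0≤β α² β² =
    square-cancel-≤ (*-nonneg 0≤α 0≤β)
      (x≤x+p _ (square-nonneg _) ⟨≤⟩
       ≈⇒≤ (trans (norm-product a (- b) b x y (-‿inverseʳ b))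
           (trans (*-cong (trans (+-congˡ (-x²≈x² b)) (sym α²)) (sym β²))
                  (solve 2 (λ α β → (α :* α) :* (β :* β) :=
                                    (α :* β) :* (α :* β)) refl α β))))

  -- Plane geometry

  d-≤-from-square : ∀ {p q p′ q′} → d p q * d p q ≈ d p′ q′ * d p′ q′ → d p q ≤ d p′ q′
  d-≤-from-square {p′ = p′} {q′} e = square-cancel-≤ (d-nonneg p′ q′) (≈⇒≤ e)

  d-≈-from-square : ∀ {p q p′ q′} → d p q * d p q ≈ d p′ q′ * d p′ q′ → d p q ≈ d p′ q′
  d-≈-from-square {p} {q} {p′} {q′} e =
    antisym (d-≤-from-square {p} {q} {p′} {q′} e) (d-≤-from-square {p′} {q′} {p} {q} (sym e))

  d-cong : ∀ p q p′ q′ → p ≈ₚ p′ → q ≈ₚ q′ → d p q ≈ d p′ q′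
  d-cong p q p′ q′ (e , f) (g , h) = d-≈-from-square {p} {q} {p′} {q′}
    (trans (d-square p q)
    (trans (+-cong (*-cong x x) (*-cong y y)) (sym (d-square p′ q′))))
    where
    x : proj₁ p - proj₁ q ≈ proj₁ p′ - proj₁ q′
    x = +-cong e (-‿cong g)
    y : proj₂ p - proj₂ q ≈ proj₂ p′ - proj₂ q′
    y = +-cong f (-‿cong h)

  -‿swap : ∀ x y → (x - y) + (y - x) ≈ 0#
  -‿swap x y = trans (sym (+-assoc _ _ _))
    (trans (+-congʳ (x-y+y≈x x y)) (-‿inverseʳ x))

  d-sym : ∀ p q → d p q ≈ d q p
  d-sym p q = d-≈-from-square {p} {q} {q} {p}
    (trans (d-square p q)
    (trans (+-cong (x+y≈0⇒x²≈y² _ _ (-‿swap _ _)) (x+y≈0⇒x²≈y² _ _ (-‿swap _ _)))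
           (sym (d-square q p))))

  -‿split : ∀ x y z → x - z ≈ (x - y) + (y - z)
  -‿split x y z = trans (+-congʳ (sym (x-y+y≈x x y))) (+-assoc _ _ _)

  -- After squaring, only the cross term has to be estimated, and this is `dot≤` for the vectors
  -- from `q` to `p` and from `r` to `q`.
  d-triangle : ∀ p q r → d p r ≤ d p q + d q r
  d-triangle p@(x , y) q@(x′ , y′) r@(x″ , y″) =
    square-cancel-≤ (+-nonneg (d-nonneg p q) (d-nonneg q r))
      (≈⇒≤ (trans (d-square p r)
           (trans (+-cong (*-cong (-‿split x x′ x″) (-‿split x x′ x″))
                          (*-cong (-‿split y y′ y″) (-‿split y y′ y″)))
           (trans (solve 4 (λ a b e f →
                     (a :+ e) :* (a :+ e) :+ (b :+ f) :* (b :+ f) :=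
                     ((a :* a :+ b :* b) :+ (e :* e :+ f :* f)) :+
                     ((a :* e :+ b :* f) :+ (a :* e :+ b :* f)))
                     refl (x - x′) (y - y′) (x′ - x″) (y′ - y″))
                  (+-congʳ (+-cong (sym (d-square p q)) (sym (d-square q r))))))) ⟨≤⟩
       +-monoʳ _ (+-mono dot dot) ⟨≤⟩
       ≈⇒≤ (solve 2 (λ α β → (α :* α :+ β :* β) :+ (α :* β :+ α :* β) :=
                             (α :+ β) :* (α :+ β)) refl (d p q) (d q r)))
    where
    dot : (x - x′) * (x′ - x″) + (y - y′) * (y′ - y″) ≤ d p q * d q r
    dot = dot≤ (d-nonneg p q) (d-nonneg q r) (d-square p q) (d-square q r)

  x-y≈0⇒x≈y : ∀ x y → x - y ≈ 0# → x ≈ y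
  x-y≈0⇒x≈y x y e = trans (sym (x-y+y≈x x y)) (trans (+-congʳ e) (+-identityˡ y))

  d≤0⇒≈ₚ : ∀ p q → d p q ≤ 0# → p ≈ₚ q
  d≤0⇒≈ₚ p q d≤0 =
    x-y≈0⇒x≈y _ _ (square≤0 _ (x≤x+p _ (square-nonneg _) ⟨≤⟩ sum≤0)) ,
    x-y≈0⇒x≈y _ _ (square≤0 _ (x≤x+p _ (square-nonneg _) ⟨≤⟩ ≈⇒≤ (+-comm _ _) ⟨≤⟩ sum≤0))
    where
    sum≤0 : (proj₁ p - proj₁ q) * (proj₁ p - proj₁ q) +
            (proj₂ p - proj₂ q) * (proj₂ p - proj₂ q) ≤ 0#
    sum≤0 = ≈⇒≤ (sym (d-square p q)) ⟨≤⟩ *-monoˡ (d-nonneg p q) d≤0 ⟨≤⟩ ≈⇒≤ (zeroʳ _)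

  ≈ₚ-refl : ∀ {p} → p ≈ₚ p
  ≈ₚ-refl = refl , refl

  ≈ₚ-sym : ∀ {p q} → p ≈ₚ q → q ≈ₚ p
  ≈ₚ-sym (e , f) = sym e , sym f

  -- Complex multiplication by P, a rotation when P lies on the circle.
  rotate : Point → Point → Point
  rotate (a , b) (x , y) = a * x + (- b) * y , b * x + a * y

  linear-difference : ∀ a m x y x′ y′ →
    (a * x + m * y) - (a * x′ + m * y′) ≈ a * (x - x′) + m * (y - y′)
  linear-difference a m x y x′ y′ =
    trans (+-congˡ (trans (sym (-‿+-comm _ _))
                          (+-cong (-‿distribʳ-* a x′) (-‿distribʳ-* m y′))))
          (solve 6 (λ a m x y u v → (a :* x :+ m :* y) :+ (a :* u :+ m :* v) :=
                                    a :* (x :+ u) :+ m :* (y :+ v))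
             refl a m x y (- x′) (- y′))

  -- Together with `to-circle`, translates between membership in `𝒞`, stated with `origin`, and
  -- distances from `centre F`.
  on-circle : ∀ (P : 𝒞) → d (centre F) (proj₁ P) ≈ 1#
  on-circle P = proj₂ P

  circle-norm : ∀ (P : 𝒞) → let (a , b) = proj₁ P in a * a + b * b ≈ 1#
  circle-norm P =
    trans (sym (trans (d-square (centre F) (proj₁ P)) (+-cong (0-x² _) (0-x² _))))
          (trans (*-cong (on-circle P) (on-circle P)) (*-identityˡ 1#))
    where
    0-x² : ∀ x → (0# - x) * (0# - x) ≈ x * x
    0-x² x = x+y≈0⇒x²≈y² _ _ (x-y+y≈x 0# x)

  -- By linearity the difference of the images is the image of the difference, and the norm is
  -- multiplicative with `P` of norm one.
  rotate-isometry : ∀ (P : 𝒞) p q →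
    d (rotate (proj₁ P) p) (rotate (proj₁ P) q) ≈ d p q
  rotate-isometry P@((a , b) , _) p@(x , y) q@(x′ , y′) =
    d-≈-from-square {rotate (a , b) p} {rotate (a , b) q} {p} {q}
      (trans (d-square (rotate (a , b) p) (rotate (a , b) q))
      (trans (+-cong (*-cong X X) (*-cong Y Y))
      (trans (norm-product a b (- b) (x - x′) (y - y′) (-‿inverseˡ b))
      (trans (*-congʳ (circle-norm P))
      (trans (*-identityˡ _) (sym (d-square p q)))))))
    where
    X : (a * x + (- b) * y) - (a * x′ + (- b) * y′) ≈ a * (x - x′) + (- b) * (y - y′)
    X = linear-difference a (- b) x y x′ y′
    Y : (b * x + a * y) - (b * x′ + a * y′) ≈ b * (x - x′) + a * (y - y′)
    Y = linear-difference b a x y x′ y′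

  rotate-origin : ∀ (P : Point) → rotate P (centre F) ≈ₚ centre F
  rotate-origin _ = trans (+-cong (zeroʳ _) (zeroʳ _)) (+-identityˡ 0#) ,
                    trans (+-cong (zeroʳ _) (zeroʳ _)) (+-identityˡ 0#)

  rotate-R : ∀ (P : Point) → rotate P R ≈ₚ P
  rotate-R _ = trans (+-cong (*-identityʳ _) (zeroʳ _)) (+-identityʳ _) ,
               trans (+-cong (*-identityʳ _) (zeroʳ _)) (+-identityʳ _)

  to-circle : ∀ p → d (centre F) p ≈ 1# → 𝒞
  to-circle p on = p , on

  rotate-on-circle : ∀ (P Q : 𝒞) → d (centre F) (rotate (proj₁ P) (proj₁ Q)) ≈ 1#
  rotate-on-circle P Q =
    trans (d-cong (centre F) (rotate (proj₁ P) (proj₁ Q))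
                  (rotate (proj₁ P) (centre F)) (rotate (proj₁ P) (proj₁ Q))
                  (≈ₚ-sym (rotate-origin (proj₁ P))) ≈ₚ-refl)
    (trans (rotate-isometry P (centre F) (proj₁ Q)) (on-circle Q))

  rotate𝒞 : 𝒞 → 𝒞 → 𝒞
  rotate𝒞 P Q = to-circle (rotate (proj₁ P) (proj₁ Q)) (rotate-on-circle P Q)

  -- Only the distances are compared, not the points, so that a path can be compared with its image
  -- under an isometry.
  pathLength-cong : ∀ {k} p p′ (q q′ : Vector Point k) →
    (∀ i → d p (q i) ≈ d p′ (q′ i)) → (∀ i j → d (q i) (q j) ≈ d (q′ i) (q′ j)) →
    pathLength p q ≈ pathLength p′ q′
  pathLength-cong {zero}  p p′ q q′ h h′ = refl
  pathLength-cong {suc k} p p′ q q′ h h′ =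
    +-cong (h zero) (pathLength-cong (q zero) (q′ zero) (λ i → q (suc i)) (λ i → q′ (suc i))
                       (λ i → h′ zero (suc i)) (λ i j → h′ (suc i) (suc j)))

  pathLength-rotate : ∀ {k} (P : 𝒞) (q : Vector Point k) →
    pathLength R q ≈ pathLength (proj₁ P) (λ i → rotate (proj₁ P) (q i))
  pathLength-rotate P q = pathLength-cong R (proj₁ P) q
    (λ i → rotate (proj₁ P) (q i))
    (λ i → trans (sym (rotate-isometry P R (q i)))
                 (d-cong (rotate (proj₁ P) R) (rotate (proj₁ P) (q i))
                         (proj₁ P) (rotate (proj₁ P) (q i)) (rotate-R (proj₁ P)) ≈ₚ-refl))
    (λ i j → sym (rotate-isometry P (q i) (q j)))

  -- Prepends one leg: `s` is the time at `p`, `u` the time at `q₀` and `t` the deadline. The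
  -- equations for `q₀` and `q₁` let a given permutation be matched by computation.
  pathLength-step : ∀ {k} p (q : Vector Point (suc k)) (σ : Permutation′ (suc k)) {q₀ q₁ s u t} →
    q (σ ⟨$⟩ʳ zero) ≡ q₀ → (λ i → q (σ ⟨$⟩ʳ suc i)) ≡ q₁ →
    d p q₀ + s ≤ u → pathLength q₀ q₁ + u ≤ t →
    ∃ λ (σ : Permutation′ (suc k)) → pathLength p (λ i → q (σ ⟨$⟩ʳ i)) + s ≤ t
  pathLength-step p q σ {s = s} ≡.refl ≡.refl first rest =
    σ ,
    (≈⇒≤ (solve 3 (λ a b c → (a :+ b) :+ c := b :+ (a :+ c)) refl
            (d p (q (σ ⟨$⟩ʳ zero)))
            (pathLength (q (σ ⟨$⟩ʳ zero)) (λ i → q (σ ⟨$⟩ʳ suc i))) s) ⟨≤⟩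
     +-monoʳ _ first ⟨≤⟩ rest)

  -- Least elements

  -- A minimum is promised only for an inhabited set, since a robot may never reach the circle.
  HasLeast : (ℝ → Set) → Set
  HasLeast A = ∃ A → ∃ λ t → A t × (∀ s → A s → t ≤ s)

  ⊎-hasLeast : ∀ {A B} → HasLeast A → HasLeast B → HasLeast (λ t → A t ⊎ B t)
  ⊎-hasLeast {A} {B} leastA leastB inhabited with em {∃ A} | em {∃ B}
  ... | no ∄A | no ∄B = contradiction inhabited
        λ { (t , inj₁ a) → ∄A (t , a) ; (t , inj₂ b) → ∄B (t , b) }
  ... | yes ∃A | no ∄B with t , a , min ← leastA ∃A =
        t , inj₁ a , λ { s (inj₁ a′) → min s a′ ; s (inj₂ b) → contradiction (s , b) ∄B }
  ... | no ∄A | yes ∃B with t , b , min ← leastB ∃B =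
        t , inj₂ b , λ { s (inj₁ a) → contradiction (s , a) ∄A ; s (inj₂ b′) → min s b′ }
  ... | yes ∃A | yes ∃B with t , a , min ← leastA ∃A | t′ , b , min′ ← leastB ∃B
                        with total t t′
  ...   | inj₁ t≤t′ = t , inj₁ a ,
          λ { s (inj₁ a′) → min s a′ ; s (inj₂ b′) → t≤t′ ⟨≤⟩ min′ s b′ }
  ...   | inj₂ t′≤t = t′ , inj₂ b ,
          λ { s (inj₁ a′) → t′≤t ⟨≤⟩ min s a′ ; s (inj₂ b′) → min′ s b′ }

  ∃-hasLeast : ∀ {n} (A : Fin n → ℝ → Set) → (∀ i → HasLeast (A i)) →
               HasLeast (λ t → ∃ λ i → A i t)
  ∃-hasLeast {zero}  A least (_ , () , _)
  ∃-hasLeast {suc n} A least (t , i , a)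
    with ⊎-hasLeast (least zero) (∃-hasLeast (A ∘ suc) (least ∘ suc)) (t , split i a)
    where
    split : ∀ {t} i → A i t → A zero t ⊎ ∃ λ j → A (suc j) t
    split zero    a = inj₁ a
    split (suc i) a = inj₂ (i , a)
  ... | t , inj₁ a , min = t , (zero , a) ,
        λ { s (zero , b) → min s (inj₁ b) ; s (suc j , b) → min s (inj₂ (j , b)) }
  ... | t , inj₂ (i , a) , min = t , (suc i , a) ,
        λ { s (zero , b) → min s (inj₁ b) ; s (suc j , b) → min s (inj₂ (j , b)) }

  -- A finite union of the singletons of the values `u i`, each of which trivially has a least
  -- element.
  argmin : ∀ {k} (u : Fin (suc k) → ℝ) → ∃ λ j → ∀ i → u j ≤ u i
  argmin u with ∃-hasLeast (λ i t → t ≡ u i) (λ _ → λ { (t , ≡.refl) → t , ≡.refl , λ { _ ≡.refl → ≤-refl } })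
                           (u zero , zero , ≡.refl)
  ... | _ , (j , ≡.refl) , min = j , λ i → min (u i) (i , ≡.refl)

  -- The infimum is the supremum of the lower bounds, of which `0#` is one.
  infimum-of : (A : ℝ → Set) → (∀ t → A t → 0# ≤ t) → ∃ A →
               ∃ λ s → (∀ t → A t → s ≤ t) × (∀ l → (∀ t → A t → l ≤ t) → l ≤ s)
  infimum-of A nonneg (t , a)
    with s , upper , least ← complete (λ l → ∀ t → A t → l ≤ t) (0# , nonneg) (t , λ l lb → lb t a) =
    s , (λ t a → least t (λ l lb → lb t a)) , upper

  -- A level set of a 1-Lipschitz function is closed: its infimum `s` satisfies `|h s - v| ≤ u - s`
  -- for every `u` in the set, and `u - s` gets arbitrarily small. The Lipschitz condition is
  -- written without subtraction or absolute value.
  levelSet-hasLeast : ∀ (h : ℝ → ℝ) v →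
    (∀ {s t} → 0# ≤ s → s ≤ t → h t + s ≤ h s + t × h s + s ≤ h t + t) →
    HasLeast (λ t → 0# ≤ t × h t ≈ v)
  levelSet-hasLeast h v lipschitz inhabited
    with s , lower , greatest ← infimum-of _ (λ _ → proj₁) inhabited =
    s , (0≤s , antisym (+-cancelʳ-≤ s (move λ u (0≤u , hu≈v) →
                          proj₂ (lipschitz 0≤s (lower u (0≤u , hu≈v))) ⟨≤⟩
                          ≈⇒≤ (+-congʳ hu≈v)))
                       (+-cancelʳ-≤ s (move λ u (0≤u , hu≈v) →
                          ≈⇒≤ (+-congʳ (sym hu≈v)) ⟨≤⟩
                          proj₁ (lipschitz 0≤s (lower u (0≤u , hu≈v)))))) ,
    lower
    where
    0≤s : 0# ≤ s
    0≤s = greatest 0# λ _ → proj₁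
    -- This replaces the limit of `u` towards `s`: `a - b` is a lower bound of the level set, hence
    -- at most `s`.
    move : ∀ {a b} → (∀ u → 0# ≤ u × h u ≈ v → a ≤ b + u) → a ≤ b + s
    move {a} {b} bound =
      ≈⇒≤ (sym (x-y+y≈x a b)) ⟨≤⟩
      +-monoˡ-≤ b (greatest (a - b) λ u u∈ →
        +-cancelʳ-≤ b (≈⇒≤ (x-y+y≈x a b) ⟨≤⟩ bound u u∈ ⟨≤⟩ ≈⇒≤ (+-comm b u))) ⟨≤⟩
      ≈⇒≤ (+-comm s b)

  -- Extended reals

  ≤±-shift : ∀ r {x y} → x ≤± y → (r +± x) ≤± (r +± y)
  ≤±-shift r ⊥±≤⊥±       = ⊥±≤⊥±
  ≤±-shift r ⊥±≤[ l ]    = ⊥±≤[ r + l ]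
  ≤±-shift r [ p ]       = [ +-monoʳ r p ]
  ≤±-shift r ⊥±≤⊤±       = ⊥±≤⊤±
  ≤±-shift r ([ k ]≤⊤±)  = [ r + k ]≤⊤±
  ≤±-shift r ⊤±≤⊤±       = ⊤±≤⊤±

  module _ {r s : ℝ} (r+s≈0 : r + s ≈ 0#) where

    +-undo : ∀ x → r + (s + x) ≈ x
    +-undo x = trans (sym (+-assoc r s x)) (trans (+-congʳ r+s≈0) (+-identityˡ x))

    shift-undo-≤ : ∀ x → (r +± (s +± x)) ≤± x
    shift-undo-≤ ⊥±    = ⊥±≤⊥±
    shift-undo-≤ [ x ] = [ ≈⇒≤ (+-undo x) ]
    shift-undo-≤ ⊤±    = ⊤±≤⊤±

    shift-undo-≥ : ∀ x → x ≤± (r +± (s +± x))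
    shift-undo-≥ ⊥±    = ⊥±≤⊥±
    shift-undo-≥ [ x ] = [ ≈⇒≤ (sym (+-undo x)) ]
    shift-undo-≥ ⊤±    = ⊤±≤⊤±

  -- Translation by `r` is undone by translation by `- r`, so `(- r) +± y` is an upper bound of `f`.
  -- This covers infinite suprema as well.
  shift-sup-≤ : ∀ {I : Set} (f : I → ℝ±) r y → (∀ i → (r +± f i) ≤± y) → (r +± sup f) ≤± y
  shift-sup-≤ f r y h = ≤±-trans ≤-trans
    (≤±-shift r (proj₂ (proj₂ (supremum f)) ((- r) +± y) λ i →
      ≤±-trans ≤-trans (shift-undo-≥ (-‿inverseˡ r) (f i)) (≤±-shift (- r) (h i))))
    (shift-undo-≤ (-‿inverseʳ r) y)

  ≤-sup : ∀ {I : Set} (f : I → ℝ±) i → f i ≤± sup f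
  ≤-sup f = proj₁ (proj₂ (supremum f))

  inf-≤ : ∀ {I : Set} (f : I → ℝ±) i → inf f ≤± f i
  inf-≤ f = proj₁ (proj₂ (infimum f))

  inf-greatest : ∀ {I : Set} (f : I → ℝ±) u → (∀ i → u ≤± f i) → u ≤± inf f
  inf-greatest f = proj₂ (proj₂ (infimum f))

  -- Trajectories

  -- The speed bound with `s` moved across, so that consecutive legs can be added up.
  Speed≤1 : (ℝ → Point) → Set
  Speed≤1 x = ∀ {s t} → 0# ≤ s → s ≤ t → d (x s) (x t) + s ≤ t

  distance-lipschitz : ∀ {x} → Speed≤1 x → ∀ p {s t} → 0# ≤ s → s ≤ t →
    d p (x t) + s ≤ d p (x s) + t × d p (x s) + s ≤ d p (x t) + t
  distance-lipschitz {x} speed p {s} {t} 0≤s s≤t =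
    step (x s) (x t) (speed 0≤s s≤t) ,
    step (x t) (x s) (≈⇒≤ (+-congʳ (d-sym (x t) (x s))) ⟨≤⟩ speed 0≤s s≤t)
    where
    step : ∀ q r → d q r + s ≤ t → d p r + s ≤ d p q + t
    step q r h = +-monoˡ-≤ s (d-triangle p q r) ⟨≤⟩ ≈⇒≤ (+-assoc _ _ _) ⟨≤⟩ +-monoʳ _ h

  -- Going back from `x t` to the common position at an earlier `s` and on to `y t` costs at most
  -- `2 (t - s)`, which is arbitrarily small because `t` is positive.
  limits-agree : ∀ {x y t} → Speed≤1 x → Speed≤1 y → ¬ (t ≤ 0#) →
    (∀ s → 0# ≤ s → ¬ (t ≤ s) → x s ≈ₚ y s) → x t ≈ₚ y t
  limits-agree {x} {y} {t} speedx speedy t≰0 agree =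
    d≤0⇒≈ₚ (x t) (y t) (≤0-from-left t≰0 λ s 0≤s t≰s →
      +-monoˡ-≤ (s + s) (d-triangle (x t) (x s) (y t)) ⟨≤⟩
      ≈⇒≤ (+-congʳ (+-cong (d-sym (x t) (x s))
                           (d-cong (x s) (y t) (y s) (y t) (agree s 0≤s t≰s) ≈ₚ-refl))) ⟨≤⟩
      ≈⇒≤ (solve 3 (λ a b s → (a :+ b) :+ (s :+ s) := (a :+ s) :+ (b :+ s))
             refl (d (x s) (x t)) (d (y s) (y t)) s) ⟨≤⟩
      +-mono (speedx 0≤s (≰⇒≥ t≰s)) (speedy 0≤s (≰⇒≥ t≰s)))

  leg : ∀ {x} → Speed≤1 x → ∀ p q {s t} → x s ≈ₚ p → x t ≈ₚ q →
        0# ≤ s → s ≤ t → d p q + s ≤ t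
  leg {x} speed p q {s} {t} at-p at-q 0≤s s≤t =
    ≈⇒≤ (+-congʳ (d-cong p q (x s) (x t) (≈ₚ-sym at-p) (≈ₚ-sym at-q))) ⟨≤⟩ speed 0≤s s≤t

  -- Selection by visiting time: the point with the earliest time comes first, and the induction
  -- continues from there with the remaining points. Each leg is no longer than the time spent on
  -- it.
  visits-in-order : ∀ {x} → Speed≤1 x → ∀ {k} (q : Vector Point k) (u : Fin k → ℝ) →
    (∀ j → x (u j) ≈ₚ q j) → ∀ p {t₀ t} → x t₀ ≈ₚ p → 0# ≤ t₀ → t₀ ≤ t →
    (∀ j → t₀ ≤ u j) → (∀ j → u j ≤ t) →
    ∃ λ (σ : Permutation′ k) → pathLength p (λ i → q (σ ⟨$⟩ʳ i)) + t₀ ≤ t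
  visits-in-order speed {zero} q u at p at₀ 0≤t₀ t₀≤t t₀≤u u≤t =
    Perm.id , (≈⇒≤ (+-identityˡ _) ⟨≤⟩ t₀≤t)
  visits-in-order speed {suc k} q u at p at₀ 0≤t₀ t₀≤t t₀≤u u≤t =
    let j , min   = argmin u
        σ , bound = visits-in-order speed (q ∘ punchIn j) (u ∘ punchIn j) (at ∘ punchIn j)
                      (q j) (at j) (0≤t₀ ⟨≤⟩ t₀≤u j) (u≤t j) (min ∘ punchIn j) (u≤t ∘ punchIn j)
    -- The inserted permutation takes `j` first and then the other indices in the order given by
    -- `σ`.
    in pathLength-step p q (Perm.insert zero j σ) ≡.refl ≡.refl
         (leg speed p (q j) at₀ (at j) 0≤t₀ (t₀≤u j)) bound

  -- The first time at which a robot is on the circle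

  module _ {n k : ℕ} (S : Strategy n k) where
    open Strategy S

    speed≤1 : ∀ T i → Speed≤1 (position T i)
    speed≤1 T i 0≤s s≤t = x≤y-z⇒x+z≤y (speed T i 0≤s s≤t)

    OnCircle : Treasures k → Fin n → ℝ → Set
    OnCircle T i t = 0# ≤ t × d (centre F) (position T i t) ≈ 1#

    CircleReached : Treasures k → ℝ → Set
    CircleReached T t = ∃ λ i → OnCircle T i t

    NotReachedBefore : ℝ → Treasures k → Set
    NotReachedBefore t T = ∀ s → CircleReached T s → t ≤ s

    visited⇒reached : ∀ T i j t → VisitedBy position T t i j →
      ∃ λ u → u ≤ t × CircleReached T u
    visited⇒reached T i j t (u , 0≤u , u≤t , at) =
      u , u≤t , i , 0≤u ,
      trans (d-cong (centre F) (position T i u) (centre F) (proj₁ (T j)) ≈ₚ-refl at) (on-circle (T j))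

    reached⇒1≤ : ∀ T t → CircleReached T t → 1# ≤ t
    reached⇒1≤ T t (i , 0≤t , on) =
      ≈⇒≤ (trans (sym on)
        (d-cong (centre F) (position T i t) (position T i 0#) (position T i t)
                (≈ₚ-sym (start T i)) ≈ₚ-refl)) ⟨≤⟩
      x+z≤y⇒x≤y ≤-refl (speed≤1 T i ≤-refl 0≤t)

    reached⇒≰0 : ∀ T t → CircleReached T t → ¬ (t ≤ 0#)
    reached⇒≰0 T t reached t≤0 = 1≰0 (reached⇒1≤ T t reached ⟨≤⟩ t≤0)

    -- The first time is attained: each robot's times on the circle form a level set of its
    -- 1-Lipschitz distance from the centre, and there are finitely many robots.
    circleReached-hasLeast : ∀ T → HasLeast (CircleReached T)
    circleReached-hasLeast T = ∃-hasLeast (OnCircle T) λ i →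
      levelSet-hasLeast (λ t → d (centre F) (position T i t)) 1#
        (distance-lipschitz (speed≤1 T i) (centre F))

    undiscovered : ∀ T t → NotReachedBefore t T → ∀ s → ¬ (t ≤ s) → ∀ j →
                   ¬ DiscoveredBy position T s j
    undiscovered T t before s t≰s j (i , visited) =
      let u , u≤s , reached = visited⇒reached T i j s visited
      in t≰s (before u reached ⟨≤⟩ u≤s)

    -- Nothing has been discovered under either placement, so every clause holds vacuously.
    sameInformation-before : ∀ T T′ t → NotReachedBefore t T → NotReachedBefore t T′ →
      ∀ s → ¬ (t ≤ s) → SameInformation position T T′ s
    sameInformation-before T T′ t before before′ s t≰s r _ r≤s j =
      mk⇔ (⊥-elim ∘ none) (⊥-elim ∘ undiscovered T′ t before′ r t≰r j) , ⊥-elim ∘ none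
      where
      t≰r : ¬ (t ≤ r)
      t≰r t≤r = t≰s (t≤r ⟨≤⟩ r≤s)
      none : ¬ DiscoveredBy position T r j
      none = undiscovered T t before r t≰r j

    -- Causality alone gives agreement strictly before `t`, since a treasure may be discovered at
    -- `t` itself. Continuity extends the agreement to `t`.
    agree-until-reached : ∀ T T′ t → ¬ (t ≤ 0#) →
      NotReachedBefore t T → NotReachedBefore t T′ →
      ∀ i → position T i t ≈ₚ position T′ i t
    agree-until-reached T T′ t t≰0 before before′ i =
      limits-agree {position T i} {position T′ i} {t} (speed≤1 T i) (speed≤1 T′ i) t≰0
        λ s 0≤s t≰s → causal T T′ s 0≤s (sameInformation-before T T′ t before before′ s t≰s) i

    onCircle-cong : ∀ T T′ i t → position T i t ≈ₚ position T′ i t → OnCircle T′ i t → OnCircle T i t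
    onCircle-cong T T′ i t agree (0≤t , on) =
      0≤t , trans (d-cong (centre F) (position T i t) (centre F) (position T′ i t) ≈ₚ-refl agree) on

    -- Let `t′` be the first reaching time for `T′`. If `t′ ≤ t`, neither placement has a reaching
    -- time before `t′`, so the robots agree at `t′`. Then the circle is reached at `t′` for `T`
    -- too, whence `t ≤ t′`.
    same-reaching-time : ∀ T T′ t → CircleReached T t → NotReachedBefore t T → NotReachedBefore t T′
    same-reaching-time T T′ t reached before s reached′ =
      let t′ , (i , on) , before′ = circleReached-hasLeast T′ (s , reached′)
          agree : t′ ≤ t → position T i t′ ≈ₚ position T′ i t′
          agree t′≤t = agree-until-reached T T′ t′ (reached⇒≰0 T′ t′ (i , on))
                         (λ r h → t′≤t ⟨≤⟩ before r h) before′ i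
          t≤t′ : t ≤ t′
          t≤t′ = [ (λ t≤t′ → t≤t′)
                 , (λ t′≤t → before t′ (i , onCircle-cong T T′ i t′ (agree t′≤t) on)) ]′ (total t t′)
      in t≤t′ ⟨≤⟩ before′ s reached′

  -- Completion times for rotated placements

  shortestPath : ∀ {k} → Treasures k → ℝ±
  shortestPath {k} T = inf λ (σ : Permutation′ k) →
    [ pathLength R (λ i → location T (σ ⟨$⟩ʳ i)) ]

  shortestPath-≤ : ∀ {k} (T : Treasures k) (σ : Permutation′ k) →
    shortestPath T ≤± [ pathLength R (λ i → location T (σ ⟨$⟩ʳ i)) ]
  shortestPath-≤ T = inf-≤ λ σ → [ pathLength R (λ i → location T (σ ⟨$⟩ʳ i)) ]

  completionTime-greatest : ∀ {n k} (S : Strategy n k) (T : Treasures k) u →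
    (∀ t → AllVisited S T t → u ≤± [ t ]) → u ≤± completionTime S T
  completionTime-greatest S T u h =
    inf-greatest {I = ∃ λ t → 0# ≤ t × AllVisited S T t} (λ i → [ proj₁ i ]) u
      λ i → h (proj₁ i) (proj₂ (proj₂ i))

  ρ-greatest : ∀ n k u → (∀ (S : Strategy n k) → u ≤± sup (completionTime S)) → u ≤± ρ n k
  ρ-greatest n k = inf-greatest λ (S : Strategy n k) → sup (completionTime S)

  1+c-least : ∀ k u → (∀ (T : Treasures k) → (1# +± shortestPath T) ≤± u) → (1# +± c k) ≤± u
  1+c-least k = shift-sup-≤ (shortestPath {k}) 1#

  rotateAll : ∀ {k} → 𝒞 → Treasures k → Treasures k
  rotateAll P T j = rotate𝒞 P (T j)

  pathLength-rotateAll : ∀ {k} P (T : Treasures k) (σ : Permutation′ k) →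
    pathLength R (λ j → location T (σ ⟨$⟩ʳ j)) ≈
    pathLength (proj₁ P) (λ j → location (rotateAll P T) (σ ⟨$⟩ʳ j))
  pathLength-rotateAll P T σ = pathLength-rotate P (λ j → location T (σ ⟨$⟩ʳ j))

  -- The order `σ` of the visits in the rotated placement is a candidate for the shortest path from
  -- `R` in `T`, with the same length. The summand one is covered by `t₀`.
  1+shortestPath≤-rotated : ∀ {k} P (T : Treasures k) {t₀ t} → 1# ≤ t₀ →
    (∃ λ (σ : Permutation′ k) →
      pathLength (proj₁ P) (λ j → location (rotateAll P T) (σ ⟨$⟩ʳ j)) + t₀ ≤ t) →
    (1# +± shortestPath T) ≤± [ t ]
  1+shortestPath≤-rotated P T 1≤t₀ (σ , path≤) = ≤±-trans ≤-trans
    (≤±-shift 1# (shortestPath-≤ T σ))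
    [ +-mono 1≤t₀ (≈⇒≤ (pathLength-rotateAll P T σ)) ⟨≤⟩ ≈⇒≤ (+-comm _ _) ⟨≤⟩ path≤ ]

  path-after-reaching : ∀ {n k} → Fin k → (S : Strategy n k) (T : Treasures k) → ∀ i t₀ p →
    let open Strategy S in
    0# ≤ t₀ → position T i t₀ ≈ₚ p → NotReachedBefore S t₀ T →
    ∀ t → (∀ j → VisitedBy position T t i j) →
    ∃ λ (σ : Permutation′ k) → pathLength p (λ j → location T (σ ⟨$⟩ʳ j)) + t₀ ≤ t
  path-after-reaching {k = k} j₀ S T i t₀ p 0≤t₀ at-p before t visited =
    visits-in-order {Strategy.position S T i} (speed≤1 S T i) (location T)
      (λ j → proj₁ (visited j)) (λ j → proj₂ (proj₂ (proj₂ (visited j)))) p at-p 0≤t₀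
      -- The treasure `j₀` yields `t₀ ≤ t`: it is visited between these times.
      (t₀≤u j₀ ⟨≤⟩ u≤t j₀) t₀≤u u≤t
    where
    u≤t : ∀ j → proj₁ (visited j) ≤ t
    u≤t j = proj₁ (proj₂ (proj₂ (visited j)))
    t₀≤u : ∀ j → t₀ ≤ proj₁ (visited j)
    t₀≤u j =
      let u , 0≤u , _ , at    = visited j
          v , v≤u , reached = visited⇒reached S T i j u (u , 0≤u , ≤-refl , at)
      in before v reached ⟨≤⟩ v≤u

  1+shortestPath≤completionTime : ∀ {n k} → Fin k → (S : Strategy n k) (T : Treasures k) →
    ∀ i t₀ → OnCircle S T i t₀ → NotReachedBefore S t₀ T →
    ∃ λ T′ → (1# +± shortestPath T) ≤± completionTime S T′
  1+shortestPath≤completionTime {n} {k} j₀ S T i t₀ (0≤t₀ , on) before =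
    rotateAll P T ,
    completionTime-greatest S (rotateAll P T) (1# +± shortestPath T) λ t all →
      1+shortestPath≤-rotated P T (reached⇒1≤ S T t₀ reached)
        (path-after-reaching j₀ S (rotateAll P T) i t₀ (proj₁ P) 0≤t₀
          -- `P` is read off from the motion under `T`, and the rotation depends on `P`. There is no
          -- circularity, because robot `i` is at `P` at time `t₀` under the rotated placement as
          -- well.
          (agree-until-reached S (rotateAll P T) T t₀ (reached⇒≰0 S T t₀ reached) before′ before i)
          before′ t (all i))
    where
    P : 𝒞
    P = to-circle (Strategy.position S T i t₀) on
    reached : CircleReached S T t₀
    reached = i , 0≤t₀ , on
    before′ : NotReachedBefore S t₀ (rotateAll P T)
    before′ = same-reaching-time S T (rotateAll P T) t₀ reached before

  1+shortestPath≤sup-completionTime : ∀ {n k} → Fin n → Fin k → (S : Strategy n k) → ∀ T →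
    Dec (∃ (CircleReached S T)) → (1# +± shortestPath T) ≤± sup (completionTime S)
  1+shortestPath≤sup-completionTime i₀ j₀ S T (no unreached) = ≤±-trans ≤-trans
    -- If the circle is never reached, no treasure is ever visited. There are then no completion
    -- times, and every bound holds for their infimum.
    (completionTime-greatest S T (1# +± shortestPath T) λ t all →
      let u , _ , reached = visited⇒reached S T i₀ j₀ t (all i₀ j₀)
      in ⊥-elim (unreached (u , reached)))
    (≤-sup (completionTime S) T)
  1+shortestPath≤sup-completionTime i₀ j₀ S T (yes everReached) =
    let t₀ , (i , on) , before = circleReached-hasLeast S T everReached
        T′ , bound = 1+shortestPath≤completionTime j₀ S T i t₀ on before
    in ≤±-trans ≤-trans bound (≤-sup (completionTime S) T′)

  1+c≤ρ-inhabited : ∀ {n k} → Fin n → Fin k → (1# +± c k) ≤± ρ n k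
  1+c≤ρ-inhabited {n} {k} i₀ j₀ = ρ-greatest n k (1# +± c k) λ S →
    1+c-least k (sup (completionTime S)) λ T →
      1+shortestPath≤sup-completionTime i₀ j₀ S T em

  -- Without robots or without treasures everything is visited at time zero and the bound fails,
  -- hence the restriction to positive `n` and `k`.
  1+c≤ρ : (n k : ℕ) .{{_ : NonZero n}} .{{_ : NonZero k}} → (1# +± c k) ≤± ρ n k
  1+c≤ρ (suc n) (suc k) = 1+c≤ρ-inhabited {suc n} {suc k} zero zero

lemma13 : (em : ExcludedMiddle 0ℓ) (F : CompleteOrderedField) →
    let open TreasureHunt em F in
    (n k : ℕ) .{{_ : NonZero n}} .{{_ : NonZero k}} →
    (1# +± c k) ≤± ρ n k
lemma13 = 1+c≤ρ
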